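{- The tautologies $STCONN(n)$ have polynomial size $AC^0(2)$-Frege proofs.
   Context: $STCONN(n)$ formalizes the st-connectivity principle on the $n\times n$ grid graph with paths given as edge sets: for each horizontal and vertical edge slot $e$ of the grid there are propositional variables $e_b$ ("$e$ is blue") and $e_r$ ("$e$ is red"). $STCONN(n)$ is the negation of the CNF whose clauses assert: each of the four corners has degree one; the upper-left and lower-right corners each touch blue edges; the other two corners each touch red edges; every other node has degree zero or two; and no node touches both a blue and a red edge. An $AC^0$-Frege (constant-depth Frege) system is a Frege system whose proof lines are formulas with unbounded fan-in $\wedge,\vee$ of depth bounded by a constant $d$; $AC^0(2)$-Frege extends it with unbounded fan-in parity gates $\oplus(x_1,\ldots,x_k)$ and axioms defining them. Polynomial size means proof size bounded by a polynomial in $n$ (for some fixed depth bound). -}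

module Defs where

open import Data.Nat using (ℕ; zero; suc; _+_; _*_; _∸_; _⊔_; _<ᵇ_; _≡ᵇ_)
open import Data.Bool using (Bool; true; false; _∧_; _∨_; not; if_then_else_)
open import Data.List using (List; []; _∷_; [_]; _++_; concatMap; length; upTo; zipWith; map)
open import Data.Product using (_×_; _,_; proj₁; proj₂)
open import Data.List.Membership.Propositional using (_∈_)

-- h i j : horizontal edge slot between nodes (i,j) and (i,j+1)
-- v i j : vertical   edge slot between nodes (i,j) and (i+1,j)
-- (i = row, counted from the top; j = column, counted from the left)
data Dir : Set where
  h v : Dir

data Colour : Set where
  blue red : Colour

record Edge : Set where
  constructor edge
  field
    dir : Dir
    row : ℕ
    col : ℕ

record Var : Set where
  constructor _colour_
  field
    slot : Edge
    col  : Colour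

data Form : Set where
  var  : Var → Form
  neg  : Form → Form
  and  : List Form → Form
  or   : List Form → Form
  xor  : List Form → Form

mutual
  fsize : Form → ℕ
  fsize (var x) = 1
  fsize (neg A) = suc (fsize A)
  fsize (and As) = suc (fsizes As)
  fsize (or As) = suc (fsizes As)
  fsize (xor As) = suc (fsizes As)

  fsizes : List Form → ℕ
  fsizes [] = 0
  fsizes (A ∷ As) = fsize A + fsizes As

mutual
  fdepth : Form → ℕ
  fdepth (var x) = 0
  fdepth (neg A) = suc (fdepth A)
  fdepth (and As) = suc (fdepths As)
  fdepth (or As) = suc (fdepths As)
  fdepth (xor As) = suc (fdepths As)

  fdepths : List Form → ℕ
  fdepths [] = 0
  fdepths (A ∷ As) = fdepth A ⊔ fdepths As

_⇔F_ : Form → Form → Form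
A ⇔F B = and (or (neg A ∷ B ∷ []) ∷ or (neg B ∷ A ∷ []) ∷ [])

-- AC⁰(2)-Frege, presented as Gentzen's sequent calculus LK with
-- unbounded fan-in connectives and the standard axioms defining ⊕:
--   ⊕() ⊢            and    ⊢ ⊕(A,As) ↔ ((A ∧ ¬⊕(As)) ∨ (¬A ∧ ⊕(As)))
-- Proofs are trees; a bound on the depth of all formulas occurring in the
-- proof is imposed separately (see pdepth).

_⊆_ : List Form → List Form → Set
Γ ⊆ Γ' = ∀ {A} → A ∈ Γ → A ∈ Γ'

infix 4 _⊢_

mutual
  data _⊢_ : List Form → List Form → Set where
    ax    : ∀ {Γ Δ A} → A ∈ Γ → A ∈ Δ → Γ ⊢ Δ
    weak  : ∀ {Γ Δ Γ' Δ'} → Γ ⊆ Γ' → Δ ⊆ Δ' → Γ ⊢ Δ → Γ' ⊢ Δ'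
    cut   : ∀ {Γ Δ} A → Γ ⊢ A ∷ Δ → A ∷ Γ ⊢ Δ → Γ ⊢ Δ
    negL  : ∀ {Γ Δ A} → Γ ⊢ A ∷ Δ → neg A ∷ Γ ⊢ Δ
    negR  : ∀ {Γ Δ A} → A ∷ Γ ⊢ Δ → Γ ⊢ neg A ∷ Δ
    andL  : ∀ {Γ Δ A As} → A ∈ As → A ∷ Γ ⊢ Δ → and As ∷ Γ ⊢ Δ
    andR  : ∀ {Γ Δ As} → PremsR Γ Δ As → Γ ⊢ and As ∷ Δ
    orL   : ∀ {Γ Δ As} → PremsL Γ Δ As → or As ∷ Γ ⊢ Δ
    orR   : ∀ {Γ Δ A As} → A ∈ As → Γ ⊢ A ∷ Δ → Γ ⊢ or As ∷ Δ
    xor0  : ∀ {Γ Δ} → xor [] ∷ Γ ⊢ Δ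
    xorS  : ∀ {Γ Δ} A As →
            Γ ⊢ (xor (A ∷ As) ⇔F
                  or (and (A ∷ neg (xor As) ∷ []) ∷ and (neg A ∷ xor As ∷ []) ∷ [])) ∷ Δ

  data PremsR (Γ Δ : List Form) : List Form → Set where
    []  : PremsR Γ Δ []
    _∷_ : ∀ {A As} → Γ ⊢ A ∷ Δ → PremsR Γ Δ As → PremsR Γ Δ (A ∷ As)

  data PremsL (Γ Δ : List Form) : List Form → Set where
    []  : PremsL Γ Δ []
    _∷_ : ∀ {A As} → A ∷ Γ ⊢ Δ → PremsL Γ Δ As → PremsL Γ Δ (A ∷ As)

ssize : List Form → List Form → ℕ
ssize Γ Δ = fsizes Γ + fsizes Δ

sdepth : List Form → List Form → ℕ
sdepth Γ Δ = fdepths Γ ⊔ fdepths Δ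

mutual
  psize : ∀ {Γ Δ} → Γ ⊢ Δ → ℕ
  psize {Γ} {Δ} (ax _ _) = ssize Γ Δ
  psize {Γ} {Δ} (weak _ _ p) = ssize Γ Δ + psize p
  psize {Γ} {Δ} (cut _ p q) = ssize Γ Δ + psize p + psize q
  psize {Γ} {Δ} (negL p) = ssize Γ Δ + psize p
  psize {Γ} {Δ} (negR p) = ssize Γ Δ + psize p
  psize {Γ} {Δ} (andL _ p) = ssize Γ Δ + psize p
  psize {Γ} {Δ} (andR ps) = ssize Γ Δ + psizeR ps
  psize {Γ} {Δ} (orL ps) = ssize Γ Δ + psizeL ps
  psize {Γ} {Δ} (orR _ p) = ssize Γ Δ + psize p
  psize {Γ} {Δ} xor0 = ssize Γ Δ
  psize {Γ} {Δ} (xorS _ _) = ssize Γ Δ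

  psizeR : ∀ {Γ Δ As} → PremsR Γ Δ As → ℕ
  psizeR [] = 0
  psizeR (p ∷ ps) = psize p + psizeR ps

  psizeL : ∀ {Γ Δ As} → PremsL Γ Δ As → ℕ
  psizeL [] = 0
  psizeL (p ∷ ps) = psize p + psizeL ps

mutual
  pdepth : ∀ {Γ Δ} → Γ ⊢ Δ → ℕ
  pdepth {Γ} {Δ} (ax _ _) = sdepth Γ Δ
  pdepth {Γ} {Δ} (weak _ _ p) = sdepth Γ Δ ⊔ pdepth p
  pdepth {Γ} {Δ} (cut _ p q) = sdepth Γ Δ ⊔ pdepth p ⊔ pdepth q
  pdepth {Γ} {Δ} (negL p) = sdepth Γ Δ ⊔ pdepth p
  pdepth {Γ} {Δ} (negR p) = sdepth Γ Δ ⊔ pdepth p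
  pdepth {Γ} {Δ} (andL _ p) = sdepth Γ Δ ⊔ pdepth p
  pdepth {Γ} {Δ} (andR ps) = sdepth Γ Δ ⊔ pdepthR ps
  pdepth {Γ} {Δ} (orL ps) = sdepth Γ Δ ⊔ pdepthL ps
  pdepth {Γ} {Δ} (orR _ p) = sdepth Γ Δ ⊔ pdepth p
  pdepth {Γ} {Δ} xor0 = sdepth Γ Δ
  pdepth {Γ} {Δ} (xorS _ _) = sdepth Γ Δ

  pdepthR : ∀ {Γ Δ As} → PremsR Γ Δ As → ℕ
  pdepthR [] = 0
  pdepthR (p ∷ ps) = pdepth p ⊔ pdepthR ps

  pdepthL : ∀ {Γ Δ As} → PremsL Γ Δ As → ℕ
  pdepthL [] = 0
  pdepthL (p ∷ ps) = pdepth p ⊔ pdepthL ps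

assignments : ℕ → List (List Bool)
assignments zero = [ [] ]
assignments (suc k) = concatMap (λ a → (false ∷ a) ∷ (true ∷ a) ∷ []) (assignments k)

litAgainst : Bool → Var → Form
litAgainst true x = neg (var x)
litAgainst false x = var x

cnf : List Var → (List Bool → Bool) → List Form
cnf xs P = concatMap (λ a → if P a then [] else [ or (zipWith litAgainst a xs) ])
                     (assignments (length xs))

incident : ℕ → ℕ → ℕ → List Edge
incident n i j =
     (if suc j <ᵇ n then [ edge h i j ] else [])
  ++ (if 0 <ᵇ j then [ edge h i (j ∸ 1) ] else [])
  ++ (if suc i <ᵇ n then [ edge v i j ] else [])
  ++ (if 0 <ᵇ i then [ edge v (i ∸ 1) j ] else [])

localVars : ℕ → ℕ → ℕ → List Var
localVars n i j = concatMap (λ e → (e colour blue) ∷ (e colour red) ∷ []) (incident n i j)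

-- read a local assignment as (blue?, red?) pairs, one per incident edge
pairs : List Bool → List (Bool × Bool)
pairs (b ∷ r ∷ bs) = (b , r) ∷ pairs bs
pairs _ = []

anyB : List Bool → Bool
anyB [] = false
anyB (b ∷ bs) = b ∨ anyB bs

degree : List Bool → ℕ
degree a = count (pairs a)
  where
  count : List (Bool × Bool) → ℕ
  count [] = 0
  count ((b , r) ∷ ps) = (if b ∨ r then 1 else 0) + count ps

degOne : List Bool → Bool
degOne a = degree a ≡ᵇ 1

degZeroOrTwo : List Bool → Bool
degZeroOrTwo a = (degree a ≡ᵇ 0) ∨ (degree a ≡ᵇ 2)

touchesBlue : List Bool → Bool
touchesBlue a = anyB (map proj₁ (pairs a))

touchesRed : List Bool → Bool
touchesRed a = anyB (map proj₂ (pairs a))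

notBoth : List Bool → Bool
notBoth a = not (touchesBlue a ∧ touchesRed a)

nodeConstraints : ℕ → ℕ → ℕ → List (List Bool → Bool)
nodeConstraints n i j =
     (if corner then [ degOne ] else [ degZeroOrTwo ])
  ++ (if isUL ∨ isLR then [ touchesBlue ] else [])
  ++ (if isUR ∨ isLL then [ touchesRed ] else [])
  ++ [ notBoth ]
  where
  top bottom left right : Bool
  top = i ≡ᵇ 0
  bottom = i ≡ᵇ (n ∸ 1)
  left = j ≡ᵇ 0
  right = j ≡ᵇ (n ∸ 1)
  isUL isUR isLL isLR corner : Bool
  isUL = top ∧ left
  isUR = top ∧ right
  isLL = bottom ∧ left
  isLR = bottom ∧ right
  corner = isUL ∨ isUR ∨ isLL ∨ isLR

nodeClauses : ℕ → ℕ → ℕ → List Form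
nodeClauses n i j = concatMap (cnf (localVars n i j)) (nodeConstraints n i j)

stconnClauses : ℕ → List Form
stconnClauses n = concatMap (λ i → concatMap (λ j → nodeClauses n i j) (upTo n)) (upTo n)

STCONN : ℕ → Form
STCONN n = neg (and (stconnClauses n))

{-# OPTIONS --safe #-}
module Submission where

-- Let G(i,j) be the parity of the red edges among the first j vertical edges from row i to row i+1, and H(i,j)
-- that of the blue edges among them, each edge (i,j') counted only if G(i,j') = 1.
-- Away from the corners, adding up the degrees modulo 2 along row i gives, for every j, that G(i-1,j) + G(i,j) + [the red edge
-- entering column j] is even, and that H(i-1,j) + H(i,j) + [the blue edge entering column j, if G(i-1,j) = 1]
-- is even: a node on a blue edge has no red edge, so G takes the same value on all sides of it.
-- The red upper-right corner thus makes every full row satisfy G = 1, H = 0, which the blue lower-right corner refutes.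
-- Every step is a tautology in at most 16 atoms that depends only on whether the node is first, inner or last
-- in its row and column. These nine tautologies get one derivation each, and substituting the
-- parities for the atoms changes the size by a polynomial factor and the depth by a constant.

open import Defs
open import Data.Nat using (ℕ; zero; suc; _+_; _*_; _^_; _∸_; _⊔_; _≤_; _<_; z≤n; s≤s; _<ᵇ_; _≡ᵇ_)
open import Data.Nat.Properties
open import Data.Nat.Tactic.RingSolver using (solve-∀)
open import Data.Bool using (Bool; true; false; _∧_; _∨_; if_then_else_)
open import Data.List using (List; []; _∷_; [_]; _++_; map; concatMap; length; upTo; zipWith)
open import Data.List.Properties using (length-upTo)
open import Data.List.Membership.Propositional using (_∈_)
open import Data.List.Membership.Propositional.Properties using (∈-++⁺ˡ; ∈-++⁺ʳ; ∈-++⁻; ∈-upTo⁺; ∈-upTo⁻)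
open import Data.List.Relation.Binary.Pointwise as Pointwise using (Pointwise; []; _∷_; ++⁺)
open import Data.List.Relation.Binary.Subset.Propositional.Properties using (++⁺ʳ)
open import Data.List.Relation.Unary.Any using (here; there)
open import Data.Product using (Σ; ∃-syntax; _×_; _,_; proj₂; map₂)
open import Data.Sum using ([_,_]′)
open import Function using (_∘_)
open import Relation.Binary.PropositionalEquality using (_≡_; refl; sym; trans; cong; cong₂; subst)

-- A decision procedure for propositional validity, with its soundness in the sequent calculus.

sameAtom : Var → Var → Bool
sameAtom (edge h a 0 colour blue) (edge h b 0 colour blue) = a ≡ᵇ b
sameAtom (edge h a 0 colour red)  (edge h b 0 colour red)  = a ≡ᵇ b
-- All schematic atoms have the shape `edge h k 0`. Other pairs may be reported distinct, since only
-- a positive answer is relied on.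
sameAtom _ _ = false

≡ᵇ-true : ∀ a b → (a ≡ᵇ b) ≡ true → a ≡ b
≡ᵇ-true zero zero _ = refl
≡ᵇ-true (suc a) (suc b) e = cong suc (≡ᵇ-true a b e)

sameAtom-sound : ∀ x y → sameAtom x y ≡ true → x ≡ y
sameAtom-sound (edge h a 0 colour blue) (edge h b 0 colour blue) e =
  cong (λ k → edge h k 0 colour blue) (≡ᵇ-true a b e)
sameAtom-sound (edge h a 0 colour red) (edge h b 0 colour red) e =
  cong (λ k → edge h k 0 colour red) (≡ᵇ-true a b e)

elem : Var → List Var → Bool
elem x [] = false
elem x (y ∷ ys) = if sameAtom x y then true else elem x ys

elem-sound : ∀ x ys → elem x ys ≡ true → x ∈ ys
elem-sound x (y ∷ ys) e with sameAtom x y in eq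
... | true  = here (sameAtom-sound x y eq)
... | false = there (elem-sound x ys e)

∈-map-var : ∀ {x ys} → x ∈ ys → var x ∈ map var ys
∈-map-var (here refl) = here refl
∈-map-var (there p) = there (∈-map-var p)

module _ (Ts Fs : List Var) where
  mutual
    -- Evaluation under the partial assignment that makes `Ts` true and `Fs` false. Both tests fail
    -- on an undetermined formula; an `xor` counts as undetermined, and the schematic tautologies
    -- contain none.
    istrue : Form → Bool
    istrue (var x) = elem x Ts
    istrue (neg A) = isfalse A
    istrue (and As) = alltrue As
    istrue (or As) = anytrue As
    istrue (xor As) = false

    isfalse : Form → Bool
    isfalse (var x) = elem x Fs
    isfalse (neg A) = istrue A
    isfalse (and As) = anyfalse As
    isfalse (or As) = allfalse As
    isfalse (xor As) = false

    alltrue anytrue allfalse anyfalse : List Form → Bool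
    alltrue [] = true
    alltrue (A ∷ As) = if istrue A then alltrue As else false
    anytrue [] = false
    anytrue (A ∷ As) = if istrue A then true else anytrue As
    allfalse [] = true
    allfalse (A ∷ As) = if isfalse A then allfalse As else false
    anyfalse [] = false
    anyfalse (A ∷ As) = if isfalse A then true else anyfalse As

  module _ {Γ Δ : List Form} (tΓ : ∀ {x} → x ∈ Ts → var x ∈ Γ) (fΔ : ∀ {x} → x ∈ Fs → var x ∈ Δ) where
    mutual
      -- True atoms sit on the left of the sequent and false atoms on the right, so an evaluation
      -- becomes a cut-free derivation.
      true-sound : ∀ A → istrue A ≡ true → Γ ⊢ A ∷ Δ
      true-sound (var x) e = ax (tΓ (elem-sound x Ts e)) (here refl)
      true-sound (neg A) e = negR (false-sound A e)
      true-sound (and As) e = andR (alltrue-sound As e)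
      true-sound (or As) e with anytrue-sound As e
      ... | _ , A∈ , π = orR A∈ π

      false-sound : ∀ A → isfalse A ≡ true → A ∷ Γ ⊢ Δ
      false-sound (var x) e = ax (here refl) (fΔ (elem-sound x Fs e))
      false-sound (neg A) e = negL (true-sound A e)
      false-sound (and As) e with anyfalse-sound As e
      ... | _ , A∈ , π = andL A∈ π
      false-sound (or As) e = orL (allfalse-sound As e)

      alltrue-sound : ∀ As → alltrue As ≡ true → PremsR Γ Δ As
      alltrue-sound [] e = []
      alltrue-sound (A ∷ As) e with istrue A in eq
      ... | true = true-sound A eq ∷ alltrue-sound As e

      allfalse-sound : ∀ As → allfalse As ≡ true → PremsL Γ Δ As
      allfalse-sound [] e = []
      allfalse-sound (A ∷ As) e with isfalse A in eq
      ... | true = false-sound A eq ∷ allfalse-sound As e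

      anytrue-sound : ∀ As → anytrue As ≡ true → ∃[ A ] (A ∈ As × (Γ ⊢ A ∷ Δ))
      anytrue-sound (A ∷ As) e with istrue A in eq
      ... | true = A , here refl , true-sound A eq
      ... | false with anytrue-sound As e
      ... | B , B∈ , π = B , there B∈ , π

      anyfalse-sound : ∀ As → anyfalse As ≡ true → ∃[ A ] (A ∈ As × (A ∷ Γ ⊢ Δ))
      anyfalse-sound (A ∷ As) e with isfalse A in eq
      ... | true = A , here refl , false-sound A eq
      ... | false with anyfalse-sound As e
      ... | B , B∈ , π = B , there B∈ , π

⊆-contract : ∀ {Γ A} → A ∈ Γ → (A ∷ Γ) ⊆ Γ
⊆-contract A∈ (here refl) = A∈
⊆-contract A∈ (there p) = p

⊆-id : ∀ {Γ} → Γ ⊆ Γ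
⊆-id p = p

undecided : List Var → List Var → List Form → List Form
undecided Ts Fs [] = []
undecided Ts Fs (A ∷ Γ) = if istrue Ts Fs A then undecided Ts Fs Γ else A ∷ undecided Ts Fs Γ

undecided-⊆ : ∀ Ts Fs Γ → undecided Ts Fs Γ ⊆ Γ
undecided-⊆ Ts Fs (A ∷ Γ) p with istrue Ts Fs A
undecided-⊆ Ts Fs (A ∷ Γ) p | true = there (undecided-⊆ Ts Fs Γ p)
undecided-⊆ Ts Fs (A ∷ Γ) (here refl) | false = here refl
undecided-⊆ Ts Fs (A ∷ Γ) (there p) | false = there (undecided-⊆ Ts Fs Γ p)

-- Dropping the hypotheses already true on a branch keeps the search over the clauses fast.
valid : List Var → List Var → List Var → List Form → List Form → Bool
valid xs Ts Fs Γ Δ = if anyfalse Ts Fs Γ then true else (if anytrue Ts Fs Δ then true else split xs)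
  where
  split : List Var → Bool
  split [] = false
  split (x ∷ xs) = if valid xs (x ∷ Ts) Fs (undecided (x ∷ Ts) Fs Γ) Δ
                   then valid xs Ts (x ∷ Fs) (undecided Ts (x ∷ Fs) Γ) Δ else false

-- A leaf of the search closes by evaluating one formula, which is then contracted into its context.
-- A split on `x` is a cut on `var x`: the left premise is the branch where `x` is false, the right
-- one where it is true.
valid-sound : ∀ xs Ts Fs Γ Δ → valid xs Ts Fs Γ Δ ≡ true → map var Ts ++ Γ ⊢ map var Fs ++ Δ
valid-sound xs Ts Fs Γ Δ e with anyfalse Ts Fs Γ in eq
... | true with anyfalse-sound Ts Fs {map var Ts ++ Γ} {map var Fs ++ Δ}
                  (λ p → ∈-++⁺ˡ (∈-map-var p)) (λ p → ∈-++⁺ˡ (∈-map-var p)) Γ eq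
... | _ , A∈ , π = weak (⊆-contract (∈-++⁺ʳ (map var Ts) A∈)) ⊆-id π
valid-sound xs Ts Fs Γ Δ e | false with anytrue Ts Fs Δ in eq′
... | true with anytrue-sound Ts Fs {map var Ts ++ Γ} {map var Fs ++ Δ}
                  (λ p → ∈-++⁺ˡ (∈-map-var p)) (λ p → ∈-++⁺ˡ (∈-map-var p)) Δ eq′
... | _ , A∈ , π = weak ⊆-id (⊆-contract (∈-++⁺ʳ (map var Fs) A∈)) π
valid-sound (x ∷ xs) Ts Fs Γ Δ e | false | false
  with valid xs (x ∷ Ts) Fs (undecided (x ∷ Ts) Fs Γ) Δ in eqT
... | true = cut (var x)
    (weak (++⁺ʳ (map var Ts) (undecided-⊆ Ts (x ∷ Fs) Γ)) ⊆-id
      (valid-sound xs Ts (x ∷ Fs) _ Δ e))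
    (weak (++⁺ʳ (var x ∷ map var Ts) (undecided-⊆ (x ∷ Ts) Fs Γ)) ⊆-id
      (valid-sound xs (x ∷ Ts) Fs _ Δ eqT))

-- The constraints at a node, up to its position in the grid, and the nine local tautologies.

data Pos : Set where
  first mid last : Pos

colours : Edge → List Var
colours e = (e colour blue) ∷ (e colour red) ∷ []

-- The tests that the clauses of a node make along one axis. With these as parameters, actual and
-- schematic clauses are instances of the same `clauses`.
record Side : Set where
  constructor side
  field
    hasNext hasPrev isFirst isLast : Bool

sideOf : Pos → Side
sideOf first = side true false true false
sideOf mid   = side true true false false
sideOf last  = side false true false true

module _ (s t : Side) where
  private
    module S = Side s
    module T = Side t

  neighbours : (R L D U : Edge) → List Edge
  neighbours R L D U =
       (if T.hasNext then [ R ] else [])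
    ++ (if T.hasPrev then [ L ] else [])
    ++ (if S.hasNext then [ D ] else [])
    ++ (if S.hasPrev then [ U ] else [])

  constraints : List (List Bool → Bool)
  constraints =
       (if isUL ∨ isUR ∨ isLL ∨ isLR then [ degOne ] else [ degZeroOrTwo ])
    ++ (if isUL ∨ isLR then [ touchesBlue ] else [])
    ++ (if isUR ∨ isLL then [ touchesRed ] else [])
    ++ [ notBoth ]
    where
    isUL isUR isLL isLR : Bool
    isUL = S.isFirst ∧ T.isFirst
    isUR = S.isFirst ∧ T.isLast
    isLL = S.isLast ∧ T.isFirst
    isLR = S.isLast ∧ T.isLast

  clauses : (R L D U : Edge) → List Form
  clauses R L D U = concatMap (cnf (concatMap colours (neighbours R L D U))) constraints

-- Schematic atoms around a node: 0–3 are the edges up, down, left, right;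
-- 4 and 5 are the parities above the node before and after its column, 6 and 7 those below it.
-- For the parities, red stands for G and blue for H.
slot : ℕ → Edge
slot k = edge h k 0

atom : ℕ → Colour → Form
atom k c = var (slot k colour c)

schemaClauses : Pos → Pos → List Form
schemaClauses p q = clauses (sideOf p) (sideOf q) (slot 3) (slot 2) (slot 1) (slot 0)

-- The formula of `xorS`, with `X` for ⊕(A,As) and `Y` for ⊕(As).
expansion : Form → Form → Form → Form
expansion X A Y = X ⇔F or (and (A ∷ neg Y ∷ []) ∷ and (neg A ∷ Y ∷ []) ∷ [])

axioms : Pos → List Form
axioms q =
    expansion (atom 5 red) (atom 0 red) (atom 4 red)
  ∷ expansion (atom 5 blue) (and (atom 0 blue ∷ atom 4 red ∷ [])) (atom 4 blue)
  ∷ expansion (atom 7 red) (atom 1 red) (atom 6 red)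
  ∷ expansion (atom 7 blue) (and (atom 1 blue ∷ atom 6 red ∷ [])) (atom 6 blue)
  ∷ initial q
  where
  initial : Pos → List Form
  initial first = neg (atom 4 red) ∷ neg (atom 4 blue) ∷ neg (atom 6 red) ∷ neg (atom 6 blue) ∷ []
  initial _ = []

-- Indices 4 6 2 give the state to the left of a node, 5 7 3 the state to its right. Three parities
-- have an even sum when the first two agree exactly if the third is 0, hence the nested
-- equivalences. In the first row G = 1 only beside a red edge, so no blue edge is ever counted. In
-- the last row the identity for H carries itself along: an edge that changes G is red and leaves
-- its node without blue edges.
invariant : Pos → (above below side : ℕ) → Form
invariant first a b e = and ((atom b red ⇔F atom e red) ∷ neg (atom b blue) ∷ [])
invariant mid a b e =
  and (((atom a red ⇔F atom b red) ⇔F neg (atom e red))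
     ∷ ((atom a blue ⇔F atom b blue) ⇔F neg (and (atom e blue ∷ atom a red ∷ []))) ∷ [])
invariant last a b e = atom a blue ⇔F and (atom e blue ∷ atom a red ∷ [])

separated : ℕ → Form
separated k = and (atom k red ∷ neg (atom k blue) ∷ [])

premises : Pos → Pos → List Form
premises p first = []
premises p mid = [ invariant p 4 6 2 ]
premises first last = [ invariant first 4 6 2 ]
premises p last = invariant p 4 6 2 ∷ separated 5 ∷ []

-- The lower-right corner touches no red edge, so G = 1 and H = 0 across the row above force its
-- left and upper edges to be both blue or both not blue, against degree one.
conclusion : Pos → Pos → Form
conclusion p first = invariant p 5 7 3
conclusion p mid = invariant p 5 7 3
conclusion last last = or []
conclusion p last = separated 7

-- Edges precede parities: the clauses leave only the few legal colourings of the edges before any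
-- parity is split.
order : Pos → Pos → List Var
order p q = concatMap colours (neighbours (sideOf p) (sideOf q) (slot 3) (slot 2) (slot 1) (slot 0))
  ++ (if Side.hasPrev (sideOf p) then above else []) ++ (if Side.hasNext (sideOf p) then below else [])
  where
  above below : List Var
  above = (slot 4 colour red) ∷ (slot 5 colour red) ∷ (slot 4 colour blue) ∷ (slot 5 colour blue) ∷ []
  below = (slot 6 colour red) ∷ (slot 7 colour red) ∷ (slot 6 colour blue) ∷ (slot 7 colour blue) ∷ []

hypotheses : Pos → Pos → List Form
hypotheses p q = premises p q ++ axioms q ++ schemaClauses p q

abstract
  -- Checked by evaluation. The `abstract` block keeps the derivations obtained from it from being
  -- unfolded where their sizes and depths are mentioned.
  local-valid : ∀ p q → valid (order p q) [] [] (hypotheses p q) [ conclusion p q ] ≡ true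
  local-valid first first = refl
  local-valid first mid = refl
  local-valid first last = refl
  local-valid mid first = refl
  local-valid mid mid = refl
  local-valid mid last = refl
  local-valid last first = refl
  local-valid last mid = refl
  local-valid last last = refl

  nodeProof : ∀ p q → hypotheses p q ⊢ [ conclusion p q ]
  nodeProof p q = valid-sound (order p q) [] [] (hypotheses p q) _ (local-valid p q)

-- Substitution in formulas and proofs, and its effect on size and depth.

module _ (σ : Var → Form) where
  mutual
    sub : Form → Form
    sub (var x) = σ x
    sub (neg A) = neg (sub A)
    sub (and As) = and (subs As)
    sub (or As) = or (subs As)
    sub (xor As) = xor (subs As)

    subs : List Form → List Form
    subs [] = []
    subs (A ∷ As) = sub A ∷ subs As

  sub-∈ : ∀ {A As} → A ∈ As → sub A ∈ subs As
  sub-∈ (here refl) = here refl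
  sub-∈ (there p) = there (sub-∈ p)

  ∈-subs : ∀ {B} As → B ∈ subs As → ∃[ A ] (A ∈ As × B ≡ sub A)
  ∈-subs (A ∷ As) (here refl) = A , here refl , refl
  ∈-subs (A ∷ As) (there p) with ∈-subs As p
  ... | C , C∈ , e = C , there C∈ , e

  subs-⊆ : ∀ {As Bs} → As ⊆ Bs → subs As ⊆ subs Bs
  subs-⊆ {As} s p with ∈-subs As p
  ... | _ , A∈ , refl = sub-∈ (s A∈)

  subs-++ : ∀ As Bs → subs (As ++ Bs) ≡ subs As ++ subs Bs
  subs-++ [] Bs = refl
  subs-++ (A ∷ As) Bs = cong (sub A ∷_) (subs-++ As Bs)

  mutual
    subProof : ∀ {Γ Δ} → Γ ⊢ Δ → subs Γ ⊢ subs Δ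
    subProof (ax p q) = ax (sub-∈ p) (sub-∈ q)
    subProof (weak s t π) = weak (subs-⊆ s) (subs-⊆ t) (subProof π)
    subProof (cut A π ρ) = cut (sub A) (subProof π) (subProof ρ)
    subProof (negL π) = negL (subProof π)
    subProof (negR π) = negR (subProof π)
    subProof (andL p π) = andL (sub-∈ p) (subProof π)
    subProof (andR πs) = andR (subPremsR πs)
    subProof (orL πs) = orL (subPremsL πs)
    subProof (orR p π) = orR (sub-∈ p) (subProof π)
    subProof xor0 = xor0
    subProof (xorS A As) = xorS (sub A) (subs As)

    subPremsR : ∀ {Γ Δ As} → PremsR Γ Δ As → PremsR (subs Γ) (subs Δ) (subs As)
    subPremsR [] = []
    subPremsR (π ∷ πs) = subProof π ∷ subPremsR πs

    subPremsL : ∀ {Γ Δ As} → PremsL Γ Δ As → PremsL (subs Γ) (subs Δ) (subs As)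
    subPremsL [] = []
    subPremsL (π ∷ πs) = subProof π ∷ subPremsL πs

+-≤-* : ∀ {a b M} s t → a ≤ s * M → b ≤ t * M → a + b ≤ (s + t) * M
+-≤-* {M = M} s t p q = ≤-trans (+-mono-≤ p q) (≤-reflexive (sym (*-distribʳ-+ M s t)))

⊔-≤-+ : ∀ {a b e} s t → a ≤ s + e → b ≤ t + e → a ⊔ b ≤ s ⊔ t + e
⊔-≤-+ {e = e} s t p q = ≤-trans (⊔-mono-≤ p q) (≤-reflexive (sym (+-distribʳ-⊔ e s t)))

module SubstitutionSize (σ : Var → Form) (M : ℕ) (1≤M : 1 ≤ M) (σ≤ : ∀ x → fsize (σ x) ≤ M) where
  mutual
    -- Every symbol becomes at most `M` symbols: an atom by the bound on `σ`, a connective because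
    -- `1 ≤ M`.
    fsize-sub : ∀ A → fsize (sub σ A) ≤ fsize A * M
    fsize-sub (var x) = ≤-trans (σ≤ x) (≤-reflexive (sym (*-identityˡ M)))
    fsize-sub (neg A) = +-mono-≤ 1≤M (fsize-sub A)
    fsize-sub (and As) = +-mono-≤ 1≤M (fsizes-subs As)
    fsize-sub (or As) = +-mono-≤ 1≤M (fsizes-subs As)
    fsize-sub (xor As) = +-mono-≤ 1≤M (fsizes-subs As)

    fsizes-subs : ∀ As → fsizes (subs σ As) ≤ fsizes As * M
    fsizes-subs [] = z≤n
    fsizes-subs (A ∷ As) = +-≤-* (fsize A) (fsizes As) (fsize-sub A) (fsizes-subs As)

  ssize-subs : ∀ Γ Δ → ssize (subs σ Γ) (subs σ Δ) ≤ ssize Γ Δ * M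
  ssize-subs Γ Δ = +-≤-* (fsizes Γ) (fsizes Δ) (fsizes-subs Γ) (fsizes-subs Δ)

  mutual
    psize-sub : ∀ {Γ Δ} (π : Γ ⊢ Δ) → psize (subProof σ π) ≤ psize π * M
    psize-sub {Γ} {Δ} (ax p q) = ssize-subs Γ Δ
    psize-sub {Γ} {Δ} (weak s t π) = +-≤-* (ssize Γ Δ) (psize π) (ssize-subs Γ Δ) (psize-sub π)
    psize-sub {Γ} {Δ} (cut A π ρ) =
      +-≤-* (ssize Γ Δ + psize π) (psize ρ) (+-≤-* (ssize Γ Δ) (psize π) (ssize-subs Γ Δ) (psize-sub π)) (psize-sub ρ)
    psize-sub {Γ} {Δ} (negL π) = +-≤-* (ssize Γ Δ) (psize π) (ssize-subs Γ Δ) (psize-sub π)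
    psize-sub {Γ} {Δ} (negR π) = +-≤-* (ssize Γ Δ) (psize π) (ssize-subs Γ Δ) (psize-sub π)
    psize-sub {Γ} {Δ} (andL p π) = +-≤-* (ssize Γ Δ) (psize π) (ssize-subs Γ Δ) (psize-sub π)
    psize-sub {Γ} {Δ} (andR πs) = +-≤-* (ssize Γ Δ) (psizeR πs) (ssize-subs Γ Δ) (psizeR-sub πs)
    psize-sub {Γ} {Δ} (orL πs) = +-≤-* (ssize Γ Δ) (psizeL πs) (ssize-subs Γ Δ) (psizeL-sub πs)
    psize-sub {Γ} {Δ} (orR p π) = +-≤-* (ssize Γ Δ) (psize π) (ssize-subs Γ Δ) (psize-sub π)
    psize-sub {Γ} {Δ} xor0 = ssize-subs Γ Δ
    psize-sub {Γ} {Δ} (xorS A As) = ssize-subs Γ Δ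

    psizeR-sub : ∀ {Γ Δ As} (πs : PremsR Γ Δ As) → psizeR (subPremsR σ πs) ≤ psizeR πs * M
    psizeR-sub [] = z≤n
    psizeR-sub (π ∷ πs) = +-≤-* (psize π) (psizeR πs) (psize-sub π) (psizeR-sub πs)

    psizeL-sub : ∀ {Γ Δ As} (πs : PremsL Γ Δ As) → psizeL (subPremsL σ πs) ≤ psizeL πs * M
    psizeL-sub [] = z≤n
    psizeL-sub (π ∷ πs) = +-≤-* (psize π) (psizeL πs) (psize-sub π) (psizeL-sub πs)

module SubstitutionDepth (σ : Var → Form) (e : ℕ) (σ≤ : ∀ x → fdepth (σ x) ≤ e) where
  mutual
    fdepth-sub : ∀ A → fdepth (sub σ A) ≤ fdepth A + e
    fdepth-sub (var x) = σ≤ x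
    fdepth-sub (neg A) = s≤s (fdepth-sub A)
    fdepth-sub (and As) = s≤s (fdepths-subs As)
    fdepth-sub (or As) = s≤s (fdepths-subs As)
    fdepth-sub (xor As) = s≤s (fdepths-subs As)

    fdepths-subs : ∀ As → fdepths (subs σ As) ≤ fdepths As + e
    fdepths-subs [] = z≤n
    fdepths-subs (A ∷ As) = ⊔-≤-+ (fdepth A) (fdepths As) (fdepth-sub A) (fdepths-subs As)

  sdepth-subs : ∀ Γ Δ → sdepth (subs σ Γ) (subs σ Δ) ≤ sdepth Γ Δ + e
  sdepth-subs Γ Δ = ⊔-≤-+ (fdepths Γ) (fdepths Δ) (fdepths-subs Γ) (fdepths-subs Δ)

  mutual
    pdepth-sub : ∀ {Γ Δ} (π : Γ ⊢ Δ) → pdepth (subProof σ π) ≤ pdepth π + e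
    pdepth-sub {Γ} {Δ} (ax p q) = sdepth-subs Γ Δ
    pdepth-sub {Γ} {Δ} (weak s t π) = ⊔-≤-+ (sdepth Γ Δ) (pdepth π) (sdepth-subs Γ Δ) (pdepth-sub π)
    pdepth-sub {Γ} {Δ} (cut A π ρ) =
      ⊔-≤-+ (sdepth Γ Δ ⊔ pdepth π) (pdepth ρ) (⊔-≤-+ (sdepth Γ Δ) (pdepth π) (sdepth-subs Γ Δ) (pdepth-sub π)) (pdepth-sub ρ)
    pdepth-sub {Γ} {Δ} (negL π) = ⊔-≤-+ (sdepth Γ Δ) (pdepth π) (sdepth-subs Γ Δ) (pdepth-sub π)
    pdepth-sub {Γ} {Δ} (negR π) = ⊔-≤-+ (sdepth Γ Δ) (pdepth π) (sdepth-subs Γ Δ) (pdepth-sub π)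
    pdepth-sub {Γ} {Δ} (andL p π) = ⊔-≤-+ (sdepth Γ Δ) (pdepth π) (sdepth-subs Γ Δ) (pdepth-sub π)
    pdepth-sub {Γ} {Δ} (andR πs) = ⊔-≤-+ (sdepth Γ Δ) (pdepthR πs) (sdepth-subs Γ Δ) (pdepthR-sub πs)
    pdepth-sub {Γ} {Δ} (orL πs) = ⊔-≤-+ (sdepth Γ Δ) (pdepthL πs) (sdepth-subs Γ Δ) (pdepthL-sub πs)
    pdepth-sub {Γ} {Δ} (orR p π) = ⊔-≤-+ (sdepth Γ Δ) (pdepth π) (sdepth-subs Γ Δ) (pdepth-sub π)
    pdepth-sub {Γ} {Δ} xor0 = sdepth-subs Γ Δ
    pdepth-sub {Γ} {Δ} (xorS A As) = sdepth-subs Γ Δ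

    pdepthR-sub : ∀ {Γ Δ As} (πs : PremsR Γ Δ As) → pdepthR (subPremsR σ πs) ≤ pdepthR πs + e
    pdepthR-sub [] = z≤n
    pdepthR-sub (π ∷ πs) = ⊔-≤-+ (pdepth π) (pdepthR πs) (pdepth-sub π) (pdepthR-sub πs)

    pdepthL-sub : ∀ {Γ Δ As} (πs : PremsL Γ Δ As) → pdepthL (subPremsL σ πs) ≤ pdepthL πs + e
    pdepthL-sub [] = z≤n
    pdepthL-sub (π ∷ πs) = ⊔-≤-+ (pdepth π) (pdepthL πs) (pdepth-sub π) (pdepthL-sub πs)

-- Derivations from the clauses, with size and depth tracked.

fsizes-++ : ∀ As Bs → fsizes (As ++ Bs) ≡ fsizes As + fsizes Bs
fsizes-++ [] Bs = refl
fsizes-++ (A ∷ As) Bs = trans (cong (fsize A +_) (fsizes-++ As Bs)) (sym (+-assoc (fsize A) _ _))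

fdepths-++ : ∀ As Bs → fdepths (As ++ Bs) ≡ fdepths As ⊔ fdepths Bs
fdepths-++ [] Bs = refl
fdepths-++ (A ∷ As) Bs = trans (cong (fdepth A ⊔_) (fdepths-++ As Bs)) (sym (⊔-assoc (fdepth A) _ _))

length-subs : ∀ σ As → length (subs σ As) ≡ length As
length-subs σ [] = refl
length-subs σ (A ∷ As) = cong suc (length-subs σ As)

-- Covers every case of `Outright`: `1 + a` for the root sequent, and `a + (a + 1)` for a premise,
-- which is `A ⊢ A` for a clause and `⊕(), K ⊢` for `empty`.
outrightCost : ℕ → ℕ
outrightCost a = 1 + a + (a + (a + 1))

outrightCosts : List Form → ℕ
outrightCosts [] = 0
outrightCosts (A ∷ As) = outrightCost (fsize A) + outrightCosts As

sequentWeight : List Form → Form → ℕ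
sequentWeight Γ B = fsizes Γ + 1 + fsizes [ B ]

-- Computed from the schematic derivation alone, hence the same at every node of one kind. The
-- weight `w` bounds each sequent of the cutting phase, and each cut adds two of them.
stepCost : (P Q : List Form) (B : Form) → P ++ Q ⊢ [ B ] → ℕ
stepCost P Q B π = w + psize π + outrightCosts Q + length (P ++ Q) * (w + w)
  where
  w : ℕ
  w = sequentWeight (P ++ Q) B

stepDepth : (Γ : List Form) (B : Form) → Γ ⊢ [ B ] → ℕ
stepDepth Γ B π = fdepths Γ ⊔ fdepth B ⊔ pdepth π

data Outright (Cl : List Form) : Form → Set where
  axiom  : ∀ A As → Outright Cl (expansion (xor (A ∷ As)) A (xor As))
  empty  : Outright Cl (neg (xor []))
  clause : ∀ {A} → A ∈ Cl → Outright Cl A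

-- Proof sizes are counted in units of M, a common bound for all formulas substituted for atoms.
module Derivations (Cl : List Form) (M D : ℕ) (1≤M : 1 ≤ M)
                   (Cl-size : fsize (and Cl) ≤ M) (Cl-depth : fdepth (and Cl) ≤ D) where

  K : Form
  K = and Cl

  record Line (t : ℕ) (A : Form) : Set where
    constructor line
    field
      proof : [ K ] ⊢ [ A ]
      depth : pdepth proof ≤ D
      size  : psize proof ≤ t * M

  data Lines : ℕ → List Form → Set where
    []  : Lines 0 []
    _∷_ : ∀ {s t A As} → Line s A → Lines t As → Lines (s + t) (A ∷ As)

  Line-mono : ∀ {s t A} → s ≤ t → Line s A → Line t A
  Line-mono s≤t (line π d p) = line π d (≤-trans p (*-monoˡ-≤ M s≤t))

  Lines-++ : ∀ {s t As Bs} → Lines s As → Lines t Bs → Lines (s + t) (As ++ Bs)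
  Lines-++ [] ms = ms
  Lines-++ {t = t} {Bs = Bs} (_∷_ {s} {s′} {A} {As} l ls) ms =
    subst (λ k → Lines k (A ∷ As ++ Bs)) (sym (+-assoc s s′ t)) (l ∷ Lines-++ ls ms)

  K-depths : fdepths [ K ] ≤ D
  K-depths = ⊔-lub Cl-depth z≤n

  K-sizes : fsizes [ K ] ≤ 1 * M
  K-sizes = +-monoˡ-≤ 0 Cl-size

  ssize-K : ∀ Γ Δ → ssize (Γ ++ [ K ]) Δ ≡ fsizes Γ + fsizes [ K ] + fsizes Δ
  ssize-K Γ Δ = cong (_+ fsizes Δ) (fsizes-++ Γ [ K ])

  sdepth-K : ∀ Γ Δ → fdepths Γ ≤ D → fdepths Δ ≤ D → sdepth (Γ ++ [ K ]) Δ ≤ D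
  sdepth-K Γ Δ p q = ⊔-lub (≤-trans (≤-reflexive (fdepths-++ Γ [ K ])) (⊔-lub p K-depths)) q

  -- Hypotheses are cut off the front while `K` stays at the end. Each cut adds its conclusion and
  -- the weakened line, both composed of formulas already weighed by `w`.
  cutAll : ∀ Γ {t w p} B → fsizes Γ + fsizes [ K ] + fsizes [ B ] ≤ w * M → fdepths Γ ≤ D → fdepths [ B ] ≤ D →
           Lines t Γ → (π : Γ ++ [ K ] ⊢ [ B ]) → pdepth π ≤ D → psize π ≤ p * M →
           Line (p + t + length Γ * (w + w)) B
  cutAll [] {p = p} B Γ-size Γ-depth B-depth [] π π-depth π-size =
    Line-mono (≤-reflexive (arith p)) (line π π-depth π-size)
    where
    arith : ∀ p → p ≡ p + 0 + 0
    arith = solve-∀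
  cutAll (A ∷ Γ) {w = w} {p = p} B Γ-size Γ-depth B-depth (_∷_ {s} {t} (line ρ ρ-depth ρ-size) ls) π π-depth π-size =
    Line-mono (≤-reflexive (arith w s p t (length Γ)))
      (cutAll Γ {w = w} {p = w + (w + s) + p} B tail-size tail-depth B-depth ls
        (cut A (weak (∈-++⁺ʳ Γ) (λ { (here refl) → here refl }) ρ) π)
        (⊔-lub (⊔-lub (sdepth-K Γ [ B ] tail-depth B-depth)
                 (⊔-lub (sdepth-K Γ (A ∷ [ B ]) tail-depth (⊔-lub A-depth B-depth)) ρ-depth)) π-depth)
        (+-≤-* (w + (w + s)) p (+-≤-* w (w + s) sB (+-≤-* w s sAB ρ-size)) π-size))
    where
    arith : ∀ w s p t l → (w + (w + s) + p) + t + l * (w + w) ≡ p + (s + t) + (w + w + l * (w + w))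
    arith = solve-∀
    swap : ∀ a g k b → a + g + k + b ≡ g + k + (a + b)
    swap = solve-∀
    A-depth : fdepth A ≤ D
    A-depth = ≤-trans (m≤m⊔n (fdepth A) (fdepths Γ)) Γ-depth
    tail-depth : fdepths Γ ≤ D
    tail-depth = ≤-trans (m≤n⊔m (fdepth A) (fdepths Γ)) Γ-depth
    tail-size : fsizes Γ + fsizes [ K ] + fsizes [ B ] ≤ w * M
    tail-size = ≤-trans (+-monoˡ-≤ (fsizes [ B ]) (+-monoˡ-≤ (fsizes [ K ]) (m≤n+m (fsizes Γ) (fsize A)))) Γ-size
    sB : ssize (Γ ++ [ K ]) [ B ] ≤ w * M
    sB = ≤-trans (≤-reflexive (ssize-K Γ [ B ])) tail-size
    sAB : ssize (Γ ++ [ K ]) (A ∷ [ B ]) ≤ w * M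
    sAB = ≤-trans (≤-reflexive (trans (ssize-K Γ (A ∷ [ B ])) (sym (swap (fsize A) (fsizes Γ) (fsizes [ K ]) (fsizes [ B ]))))) Γ-size

  outright : ∀ {A} a → Outright Cl A → fdepth A ≤ D → fsize A ≤ a * M → Line (outrightCost a) A
  outright {A} a o A-depth A-size = go o
    where
    A-sizes : fsizes [ A ] ≤ a * M
    A-sizes = ≤-trans (≤-reflexive (+-identityʳ _)) A-size
    A-depths : fdepths [ A ] ≤ D
    A-depths = ⊔-lub A-depth z≤n
    root : ssize [ K ] [ A ] ≤ (1 + a) * M
    root = +-≤-* 1 a K-sizes A-sizes
    rootd : sdepth [ K ] [ A ] ≤ D
    rootd = ⊔-lub K-depths A-depths
    go : Outright Cl A → Line (outrightCost a) A
    go (axiom B Bs) = Line-mono (m≤m+n (1 + a) _) (line (xorS B Bs) rootd root)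
    go empty = line (negR xor0)
             (⊔-lub rootd (⊔-lub (⊔-lub (≤-trans (s≤s z≤n) A-depth) K-depths) z≤n))
             (+-≤-* (1 + a) (a + (a + 1)) root
                 (≤-trans (≤-reflexive (+-identityʳ _))
                   (+-≤-* a (a + 1) (≤-trans (s≤s z≤n) A-size)
                     (≤-trans K-sizes (*-monoˡ-≤ M (m≤n+m 1 a))))))
    go (clause A∈) = line (andL A∈ (ax (here refl) (here refl)))
             (⊔-lub rootd (⊔-lub A-depths A-depths))
             (+-≤-* (1 + a) (a + (a + 1)) root
                 (+-≤-* a (a + 1) A-sizes (≤-trans A-sizes (*-monoˡ-≤ M (m≤m+n a 1)))))

  -- Two units pay for `⊢ ¬K`, one for `K ⊢`, two for `or [], K ⊢`, and `t` for the given line.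
  refute : ∀ {t} → Line t (or []) → Σ ([] ⊢ [ neg K ]) (λ π → (pdepth π ≤ suc D) × (psize π ≤ (5 + t) * M))
  refute {t} (line π π-depth π-size) =
    negR (cut (or []) π (orL [])) ,
    ⊔-lub (⊔-lub (s≤s Cl-depth) z≤n)
      (⊔-lub (⊔-lub (≤-trans K-depths (n≤1+n D)) (≤-trans π-depth (n≤1+n D)))
        (⊔-lub (⊔-lub (⊔-lub (s≤s z≤n) (≤-trans K-depths (n≤1+n D))) z≤n) z≤n)) ,
    ≤-trans (+-≤-* 2 (1 + t + 2) (≤-trans (≤-reflexive (+-identityʳ _)) (+-≤-* 1 1 1≤1*M K-size))
              (+-≤-* (1 + t) 2 (+-≤-* 1 t (≤-trans (≤-reflexive (+-identityʳ _)) K-sizes) π-size)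
                (≤-trans (≤-reflexive (trans (+-identityʳ _) (+-identityʳ _))) (+-≤-* 1 1 1≤1*M K-sizes))))
            (≤-reflexive (cong (_* M) (arith t)))
    where
    1≤1*M : 1 ≤ 1 * M
    1≤1*M = ≤-trans 1≤M (≤-reflexive (sym (*-identityˡ M)))
    K-size : fsize K ≤ 1 * M
    K-size = ≤-trans Cl-size (≤-reflexive (sym (*-identityˡ M)))
    arith : ∀ t → 2 + (1 + t + 2) ≡ 5 + t
    arith = solve-∀

  module Instance (σ : Var → Form) (e : ℕ) (σ-size : ∀ x → fsize (σ x) ≤ M) (σ-depth : ∀ x → fdepth (σ x) ≤ e) where
    open SubstitutionSize σ M 1≤M σ-size
    open SubstitutionDepth σ e σ-depth

    outrights : ∀ Q → (∀ {A} → A ∈ Q → Outright Cl (sub σ A)) → fdepths (subs σ Q) ≤ D →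
                Lines (outrightCosts Q) (subs σ Q)
    outrights [] o d = []
    outrights (A ∷ Q) o d =
      outright (fsize A) (o (here refl)) (≤-trans (m≤m⊔n (fdepth (sub σ A)) (fdepths (subs σ Q))) d) (fsize-sub A)
      ∷ outrights Q (o ∘ there) (≤-trans (m≤n⊔m (fdepth (sub σ A)) (fdepths (subs σ Q))) d)

    -- One instance of a schematic derivation: the instances of `P` come from earlier lines, those
    -- of `Q` are proved outright, and all are cut away.
    step : ∀ P Q B (π : P ++ Q ⊢ [ B ]) {t} → stepDepth (P ++ Q) B π + e ≤ D →
           (∀ {A} → A ∈ Q → Outright Cl (sub σ A)) →
           Lines t (subs σ P) → Line (t + stepCost P Q B π) (sub σ B)
    step P Q B π {t} π-depth o ls =
      Line-mono (≤-reflexive (trans (cong (λ l → w + psize π + (t + outrightCosts Q) + l * (w + w)) (length-subs σ Γ))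
                                    (arith w (psize π) t (outrightCosts Q) (length Γ * (w + w)))))
        (cutAll (subs σ Γ) {w = w} {p = w + psize π} (sub σ B) size Γ-depth B-depth
          (subst (Lines _) (sym (subs-++ σ P Q)) (Lines-++ ls (outrights Q o Q-depth)))
          (weak ∈-++⁺ˡ ⊆-id (subProof σ π))
          (⊔-lub (sdepth-K (subs σ Γ) [ sub σ B ] Γ-depth B-depth)
                 (≤-trans (pdepth-sub π) (≤-trans (+-monoˡ-≤ e (m≤n⊔m (fdepths Γ ⊔ fdepth B) (pdepth π))) π-depth)))
          (+-≤-* w (psize π) (≤-trans (≤-reflexive (ssize-K (subs σ Γ) [ sub σ B ])) size) (psize-sub π)))
      where
      Γ : List Form
      Γ = P ++ Q
      w : ℕ
      w = sequentWeight Γ B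
      arith : ∀ w p t o l → w + p + (t + o) + l ≡ t + (w + p + o + l)
      arith = solve-∀
      size : fsizes (subs σ Γ) + fsizes [ K ] + fsizes [ sub σ B ] ≤ w * M
      size = +-≤-* (fsizes Γ + 1) (fsizes [ B ]) (+-≤-* (fsizes Γ) 1 (fsizes-subs Γ) K-sizes) (fsizes-subs [ B ])
      Γ-depth : fdepths (subs σ Γ) ≤ D
      Γ-depth = ≤-trans (fdepths-subs Γ)
        (≤-trans (+-monoˡ-≤ e (≤-trans (m≤m⊔n (fdepths Γ) (fdepth B)) (m≤m⊔n (fdepths Γ ⊔ fdepth B) (pdepth π)))) π-depth)
      B-depth : fdepths [ sub σ B ] ≤ D
      B-depth = ⊔-lub (≤-trans (fdepth-sub B)
        (≤-trans (+-monoˡ-≤ e (≤-trans (m≤n⊔m (fdepths Γ) (fdepth B)) (m≤m⊔n (fdepths Γ ⊔ fdepth B) (pdepth π)))) π-depth)) z≤n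
      Q-depth : fdepths (subs σ Q) ≤ D
      Q-depth = ≤-trans (m≤n⊔m (fdepths (subs σ P)) (fdepths (subs σ Q)))
        (≤-trans (≤-reflexive (sym (trans (cong fdepths (subs-++ σ P Q)) (fdepths-++ (subs σ P) (subs σ Q))))) Γ-depth)

-- Clauses under a renaming of edge variables.

subs-concatMap : ∀ {X : Set} σ (f g : X → List Form) → (∀ x → subs σ (f x) ≡ g x) →
                 ∀ xs → subs σ (concatMap f xs) ≡ concatMap g xs
subs-concatMap σ f g e [] = refl
subs-concatMap σ f g e (x ∷ xs) =
  trans (subs-++ σ (f x) (concatMap f xs)) (cong₂ _++_ (e x) (subs-concatMap σ f g e xs))

module _ (σ : Var → Form) where
  Renames : Var → Var → Set
  Renames x y = σ x ≡ var y

  RenamesEdge : Edge → Edge → Set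
  RenamesEdge e f = ∀ c → Renames (e colour c) (f colour c)

  subs-literals : ∀ {xs ys} a → Pointwise Renames xs ys →
                  subs σ (zipWith litAgainst a xs) ≡ zipWith litAgainst a ys
  subs-literals [] rs = refl
  subs-literals (b ∷ a) [] = refl
  subs-literals (true ∷ a) (r ∷ rs) = cong₂ _∷_ (cong neg r) (subs-literals a rs)
  subs-literals (false ∷ a) (r ∷ rs) = cong₂ _∷_ r (subs-literals a rs)

  -- `cnf` selects its assignments from `P` and the number of variables alone, so a renaming acts
  -- literal by literal.
  subs-cnf : ∀ {xs ys} P → Pointwise Renames xs ys → subs σ (cnf xs P) ≡ cnf ys P
  subs-cnf {xs} {ys} P rs = trans
    (subs-concatMap σ _ (λ a → if P a then [] else [ or (zipWith litAgainst a ys) ]) each (assignments (length xs)))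
    (cong (λ l → concatMap (λ a → if P a then [] else [ or (zipWith litAgainst a ys) ]) (assignments l))
          (Pointwise.Pointwise-length rs))
    where
    each : ∀ a → subs σ (if P a then [] else [ or (zipWith litAgainst a xs) ])
               ≡ (if P a then [] else [ or (zipWith litAgainst a ys) ])
    each a with P a
    ... | true = refl
    ... | false = cong (λ ls → [ or ls ]) (subs-literals a rs)

  colours-Renames : ∀ {es fs} → Pointwise RenamesEdge es fs →
                    Pointwise Renames (concatMap colours es) (concatMap colours fs)
  colours-Renames [] = []
  colours-Renames (r ∷ rs) = r blue ∷ r red ∷ colours-Renames rs

  optional : ∀ b {e f} → RenamesEdge e f →
             Pointwise RenamesEdge (if b then [ e ] else []) (if b then [ f ] else [])
  optional true r = r ∷ []
  optional false r = []

  subs-clauses : ∀ s t {R L D U R′ L′ D′ U′} →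
                 RenamesEdge R R′ → RenamesEdge L L′ → RenamesEdge D D′ → RenamesEdge U U′ →
                 subs σ (clauses s t R L D U) ≡ clauses s t R′ L′ D′ U′
  subs-clauses s t r l d u = subs-concatMap σ _ _
    (λ P → subs-cnf P (colours-Renames
      (++⁺ (optional (Side.hasNext t) r) (++⁺ (optional (Side.hasPrev t) l)
        (++⁺ (optional (Side.hasNext s) d) (optional (Side.hasPrev s) u))))))
    (constraints s t)

-- Parities in the grid and positions of nodes.

edgeAt : ℕ → ℕ → ℕ → Edge
edgeAt i j 0 = edge v (i ∸ 1) j
edgeAt i j 1 = edge v i j
edgeAt i j 2 = edge h i (j ∸ 1)
edgeAt i j _ = edge h i j

-- The newest column is at the head, so that passing one column is literally an instance of `xorS`.
crossings : Colour → ℕ → ℕ → List Form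
crossings c i zero = []
crossings red i (suc j) = var (edge v i j colour red) ∷ crossings red i j
crossings blue i (suc j) =
  and (var (edge v i j colour blue) ∷ xor (crossings red i j) ∷ []) ∷ crossings blue i j

parity : Colour → ℕ → ℕ → Form
parity c i j = xor (crossings c i j)

-- A pure renaming, by which the clauses of a grid node are measured against the schematic ones
-- without growth.
relabel : ℕ → ℕ → Var → Form
relabel i j (edge _ k _ colour c) = var (edgeAt i j k colour c)

-- On the border, truncated subtraction and edges outside the grid give some atoms values without
-- geometric meaning. The expansions hold for these too, and the clauses mention only existing
-- neighbours.
assign : ℕ → ℕ → Var → Form
assign i j (edge _ 4 _ colour c) = parity c (i ∸ 1) j
assign i j (edge _ 5 _ colour c) = parity c (i ∸ 1) (suc j)
assign i j (edge _ 6 _ colour c) = parity c i j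
assign i j (edge _ 7 _ colour c) = parity c i (suc j)
assign i j x = relabel i j x

data At (m : ℕ) : Pos → ℕ → Set where
  first : At m first 0
  mid   : ∀ {i} → i < m → At m mid (suc i)
  last  : At m last (suc m)

At-< : ∀ {m p i} → At m p i → i < suc (suc m)
At-< first = s≤s z≤n
At-< (mid i<m) = s≤s (m<n⇒m<1+n i<m)
At-< last = ≤-refl

locate : ∀ m i → i < suc (suc m) → ∃[ p ] At m p i
locate m zero _ = first , first
locate zero (suc zero) _ = last , last
locate zero (suc (suc i)) (s≤s (s≤s ()))
locate (suc m) (suc zero) _ = mid , mid (s≤s z≤n)
locate (suc m) (suc (suc i)) (s≤s lt) with locate m (suc i) lt
... | _ , mid i<m = mid , mid (s≤s i<m)
... | _ , last = last , last

<ᵇ-true : ∀ {i m} → i < m → (i <ᵇ m) ≡ true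
<ᵇ-true {zero} (s≤s _) = refl
<ᵇ-true {suc i} (s≤s p) = <ᵇ-true p

≡ᵇ-false : ∀ {i m} → i < m → (i ≡ᵇ m) ≡ false
≡ᵇ-false {zero} (s≤s _) = refl
≡ᵇ-false {suc i} (s≤s p) = ≡ᵇ-false p

<ᵇ-irrefl : ∀ m → (m <ᵇ m) ≡ false
<ᵇ-irrefl zero = refl
<ᵇ-irrefl (suc m) = <ᵇ-irrefl m

≡ᵇ-refl : ∀ m → (m ≡ᵇ m) ≡ true
≡ᵇ-refl zero = refl
≡ᵇ-refl (suc m) = ≡ᵇ-refl m

gridSide : ℕ → ℕ → Side
gridSide n i = side (suc i <ᵇ n) (0 <ᵇ i) (i ≡ᵇ 0) (i ≡ᵇ n ∸ 1)

gridSide-At : ∀ {m p i} → At m p i → gridSide (suc (suc m)) i ≡ sideOf p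
gridSide-At first = refl
gridSide-At (mid i<m) = cong₂ (λ a b → side a true false b) (<ᵇ-true i<m) (≡ᵇ-false i<m)
gridSide-At {m} last = cong₂ (λ a b → side a true false b) (<ᵇ-irrefl m) (≡ᵇ-refl m)

-- `nodeClauses` unfolds to `clauses` at `gridSide`, so only the tests along the two axes have to be
-- evaluated.
nodeClauses-At : ∀ {m p q i j} → At m p i → At m q j →
  nodeClauses (suc (suc m)) i j ≡ clauses (sideOf p) (sideOf q) (edge h i j) (edge h i (j ∸ 1)) (edge v i j) (edge v (i ∸ 1) j)
nodeClauses-At {i = i} {j} x y =
  cong₂ (λ s t → clauses s t (edge h i j) (edge h i (j ∸ 1)) (edge v i j) (edge v (i ∸ 1) j)) (gridSide-At x) (gridSide-At y)

subs-schemaClauses : ∀ {m p q i j} σ → (∀ k c → k < 4 → σ (slot k colour c) ≡ var (edgeAt i j k colour c)) →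
  At m p i → At m q j → subs σ (schemaClauses p q) ≡ nodeClauses (suc (suc m)) i j
subs-schemaClauses {p = p} {q} σ r x y = trans
  (subs-clauses σ (sideOf p) (sideOf q)
    (λ c → r 3 c ≤-refl) (λ c → r 2 c (s≤s (s≤s (s≤s z≤n)))) (λ c → r 1 c (s≤s (s≤s z≤n))) (λ c → r 0 c (s≤s z≤n)))
  (sym (nodeClauses-At x y))

assign-edge : ∀ i j k c → k < 4 → assign i j (slot k colour c) ≡ var (edgeAt i j k colour c)
assign-edge i j 0 c _ = refl
assign-edge i j 1 c _ = refl
assign-edge i j 2 c _ = refl
assign-edge i j 3 c _ = refl
assign-edge i j (suc (suc (suc (suc k)))) c (s≤s (s≤s (s≤s (s≤s ()))))

-- Bounds on the clauses, the parities and the whole proof.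

fsizes-concatMap : ∀ {X : Set} (f : X → List Form) b xs → (∀ {x} → x ∈ xs → fsizes (f x) ≤ b) →
                   fsizes (concatMap f xs) ≤ length xs * b
fsizes-concatMap f b [] p = z≤n
fsizes-concatMap f b (x ∷ xs) p = ≤-trans (≤-reflexive (fsizes-++ (f x) (concatMap f xs)))
  (+-mono-≤ (p (here refl)) (fsizes-concatMap f b xs (p ∘ there)))

fdepths-concatMap : ∀ {X : Set} (f : X → List Form) b xs → (∀ {x} → x ∈ xs → fdepths (f x) ≤ b) →
                    fdepths (concatMap f xs) ≤ b
fdepths-concatMap f b [] p = z≤n
fdepths-concatMap f b (x ∷ xs) p = ≤-trans (≤-reflexive (fdepths-++ (f x) (concatMap f xs)))
  (⊔-lub (p (here refl)) (fdepths-concatMap f b xs (p ∘ there)))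

∈-concatMap : ∀ {X : Set} (f : X → List Form) {x xs A} → x ∈ xs → A ∈ f x → A ∈ concatMap f xs
∈-concatMap f (here refl) A∈ = ∈-++⁺ˡ A∈
∈-concatMap f {xs = y ∷ _} (there x∈) A∈ = ∈-++⁺ʳ (f y) (∈-concatMap f x∈ A∈)

nodeClauses-∈ : ∀ {n i j A} → i < n → j < n → A ∈ nodeClauses n i j → A ∈ stconnClauses n
nodeClauses-∈ {n} {i} {j} i<n j<n A∈ =
  ∈-concatMap (λ i → concatMap (nodeClauses n i) (upTo n)) (∈-upTo⁺ i<n) (∈-concatMap (nodeClauses n i) (∈-upTo⁺ j<n) A∈)

fsizes-stconnClauses : ∀ n b → (∀ {i j} → i < n → j < n → fsizes (nodeClauses n i j) ≤ b) →
                       fsizes (stconnClauses n) ≤ n * (n * b)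
fsizes-stconnClauses n b p = ≤-trans
  (fsizes-concatMap (λ i → concatMap (nodeClauses n i) (upTo n)) (n * b) (upTo n) (λ {i} i∈ → ≤-trans
    (fsizes-concatMap (nodeClauses n i) b (upTo n) (λ j∈ → p (∈-upTo⁻ i∈) (∈-upTo⁻ j∈)))
    (≤-reflexive (cong (_* b) (length-upTo n)))))
  (≤-reflexive (cong (_* (n * b)) (length-upTo n)))

fdepths-stconnClauses : ∀ n b → (∀ {i j} → i < n → j < n → fdepths (nodeClauses n i j) ≤ b) →
                        fdepths (stconnClauses n) ≤ b
fdepths-stconnClauses n b p =
  fdepths-concatMap (λ i → concatMap (nodeClauses n i) (upTo n)) b (upTo n) (λ {i} i∈ →
    fdepths-concatMap (nodeClauses n i) b (upTo n) (λ j∈ → p (∈-upTo⁻ i∈) (∈-upTo⁻ j∈)))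

≤-sum₃ : ∀ (g : Pos → ℕ) p → g p ≤ g first + (g mid + g last)
≤-sum₃ g first = m≤m+n _ _
≤-sum₃ g mid = ≤-trans (m≤m+n (g mid) (g last)) (m≤n+m _ (g first))
≤-sum₃ g last = ≤-trans (m≤n+m (g last) (g mid)) (m≤n+m _ (g first))

-- Abstract so that the constants below are never evaluated.
abstract
  total : (Pos → Pos → ℕ) → ℕ
  total f = row first + (row mid + row last)
    where
    row : Pos → ℕ
    row p = f p first + (f p mid + f p last)

  ≤-total₉ : ∀ f p q → f p q ≤ total f
  ≤-total₉ f p q = ≤-trans (≤-sum₃ (f p) q) (≤-sum₃ (λ p → f p first + (f p mid + f p last)) p)

nodeSize nodeCost nodeDepth : Pos → Pos → ℕ
nodeSize p q = fsizes (schemaClauses p q)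
nodeCost p q = stepCost (premises p q) (axioms q ++ schemaClauses p q) (conclusion p q) (nodeProof p q)
-- The 3 is the depth of a blue parity, an `xor` of conjunctions that contain an `xor`.
nodeDepth p q = stepDepth (hypotheses p q) (conclusion p q) (nodeProof p q) + 3

maxSize maxCost maxDepth : ℕ
maxSize = total nodeSize
maxCost = total nodeCost
maxDepth = total nodeDepth

-- A blue term contains a whole red parity, hence the quadratic bound.
fsizes-crossings : ∀ c i j → fsizes (crossings c i j) ≤ j * (3 + j)
fsizes-crossings c i zero = z≤n
fsizes-crossings red i (suc j) = +-mono-≤ {1} {4 + j} (s≤s z≤n)
  (≤-trans (fsizes-crossings red i j) (*-monoʳ-≤ j (n≤1+n (3 + j))))
fsizes-crossings blue i (suc j) = +-mono-≤ {_} {4 + j}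
  (≤-trans (≤-reflexive (cong (3 +_) (trans (+-identityʳ _) (fsizes-red j)))) (n≤1+n (3 + j)))
  (≤-trans (fsizes-crossings blue i j) (*-monoʳ-≤ j (n≤1+n (3 + j))))
  where
  fsizes-red : ∀ j → fsizes (crossings red i j) ≡ j
  fsizes-red zero = refl
  fsizes-red (suc j) = cong suc (fsizes-red j)

fdepths-crossings : ∀ c i j → fdepths (crossings c i j) ≤ 2
fdepths-crossings c i zero = z≤n
fdepths-crossings red i (suc j) = fdepths-crossings red i j
fdepths-crossings blue i (suc j) = ⊔-lub (s≤s (s≤s (fdepths-red j))) (fdepths-crossings blue i j)
  where
  fdepths-red : ∀ j → fdepths (crossings red i j) ≤ 0
  fdepths-red zero = z≤n
  fdepths-red (suc j) = fdepths-red j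

assign-depth : ∀ i j x → fdepth (assign i j x) ≤ 3
assign-depth i j (edge _ 0 _ colour c) = z≤n
assign-depth i j (edge _ 1 _ colour c) = z≤n
assign-depth i j (edge _ 2 _ colour c) = z≤n
assign-depth i j (edge _ 3 _ colour c) = z≤n
assign-depth i j (edge _ 4 _ colour c) = s≤s (fdepths-crossings c (i ∸ 1) j)
assign-depth i j (edge _ 5 _ colour c) = s≤s (fdepths-crossings c (i ∸ 1) (suc j))
assign-depth i j (edge _ 6 _ colour c) = s≤s (fdepths-crossings c i j)
assign-depth i j (edge _ 7 _ colour c) = s≤s (fdepths-crossings c i (suc j))
assign-depth i j (edge _ (suc (suc (suc (suc (suc (suc (suc (suc _)))))))) _ colour c) = z≤n

parity-size : ∀ {n} c i j → 1 ≤ n → j ≤ n → fsize (parity c i j) ≤ 5 * (n * n)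
parity-size {n} c i j 1≤n j≤n = begin
  1 + fsizes (crossings c i j) ≤⟨ s≤s (fsizes-crossings c i j) ⟩
  1 + j * (3 + j)              ≤⟨ s≤s (*-mono-≤ j≤n (+-monoʳ-≤ 3 j≤n)) ⟩
  1 + n * (3 + n)              ≤⟨ +-mono-≤ 1≤n (*-monoʳ-≤ n (+-monoˡ-≤ n (*-monoʳ-≤ 3 1≤n))) ⟩
  n + n * (3 * n + n)          ≤⟨ +-monoˡ-≤ _ (≤-trans (≤-reflexive (sym (*-identityʳ n))) (*-monoʳ-≤ n 1≤n)) ⟩
  n * n + n * (3 * n + n)      ≡⟨ arith n ⟩
  5 * (n * n)                  ∎
  where
  open ≤-Reasoning
  arith : ∀ n → n * n + n * (3 * n + n) ≡ 5 * (n * n)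
  arith = solve-∀

assign-size : ∀ {n M} i j → j < n → 5 * (n * n) ≤ M → ∀ x → fsize (assign i j x) ≤ M
assign-size {n} {M} i j j<n le = go
  where
  1≤n : 1 ≤ n
  1≤n = ≤-trans (s≤s z≤n) j<n
  1≤M : 1 ≤ M
  1≤M = ≤-trans (*-mono-≤ {1} {5} (s≤s z≤n) (*-mono-≤ 1≤n 1≤n)) le
  go : ∀ x → fsize (assign i j x) ≤ M
  go (edge _ 0 _ colour c) = 1≤M
  go (edge _ 1 _ colour c) = 1≤M
  go (edge _ 2 _ colour c) = 1≤M
  go (edge _ 3 _ colour c) = 1≤M
  go (edge _ 4 _ colour c) = ≤-trans (parity-size c (i ∸ 1) j 1≤n (<⇒≤ j<n)) le
  go (edge _ 5 _ colour c) = ≤-trans (parity-size c (i ∸ 1) (suc j) 1≤n j<n) le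
  go (edge _ 6 _ colour c) = ≤-trans (parity-size c i j 1≤n (<⇒≤ j<n)) le
  go (edge _ 7 _ colour c) = ≤-trans (parity-size c i (suc j) 1≤n j<n) le
  go (edge _ (suc (suc (suc (suc (suc (suc (suc (suc _)))))))) _ colour c) = 1≤M

nodeClauses-size : ∀ {m p q i j} → At m p i → At m q j → fsizes (nodeClauses (suc (suc m)) i j) ≤ maxSize
nodeClauses-size {p = p} {q} {i} {j} x y = ≤-trans
  (≤-trans (≤-reflexive (cong fsizes (sym (subs-schemaClauses (relabel i j) (λ _ _ _ → refl) x y))))
    (≤-trans (fsizes-subs (schemaClauses p q)) (≤-reflexive (*-identityʳ _))))
  (≤-total₉ nodeSize p q)
  where open SubstitutionSize (relabel i j) 1 ≤-refl (λ _ → ≤-refl)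

nodeClauses-depth : ∀ {m p q i j} → At m p i → At m q j → fdepths (nodeClauses (suc (suc m)) i j) ≤ maxDepth
nodeClauses-depth {p = p} {q} {i} {j} x y = ≤-trans
  (≤-trans (≤-reflexive (cong fdepths (sym (subs-schemaClauses (relabel i j) (λ _ _ _ → refl) x y))))
    (≤-trans (fdepths-subs (schemaClauses p q)) (+-monoˡ-≤ 3 below)))
  (≤-total₉ nodeDepth p q)
  where
  open SubstitutionDepth (relabel i j) 3 (λ _ → z≤n)
  below : fdepths (schemaClauses p q) ≤ stepDepth (hypotheses p q) (conclusion p q) (nodeProof p q)
  below = ≤-trans (m≤n⊔m (fdepths (axioms q)) _) (≤-trans (≤-reflexive (sym (fdepths-++ (axioms q) (schemaClauses p q))))
    (≤-trans (m≤n⊔m (fdepths (premises p q)) _) (≤-trans (≤-reflexive (sym (fdepths-++ (premises p q) _)))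
      (≤-trans (m≤m⊔n _ (fdepth (conclusion p q))) (m≤m⊔n _ (pdepth (nodeProof p q)))))))

quadratic : ∀ n s a → a ≤ 5 * (n * n) → a + n * (n * s) ≤ (5 + s) * (n * n)
quadratic n s a a≤ = ≤-trans (+-monoˡ-≤ (n * (n * s)) a≤) (≤-reflexive (trans
  (cong (5 * (n * n) +_) (trans (sym (*-assoc n n s)) (*-comm (n * n) s))) (sym (*-distribʳ-+ (n * n) 5 s))))

abstract
  -- The unit `M`: `5 * (n * n)` accommodates a parity, and `s` is the allowance for the clauses of
  -- one node.
  budget : ℕ → ℕ → ℕ
  budget s n = (5 + s) * (n * n)

  budget-parity : ∀ s n → 5 * (n * n) ≤ budget s n
  budget-parity s n = *-monoˡ-≤ (n * n) (m≤m+n 5 s)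

  budget-clauses : ∀ s {n} → 1 ≤ n * n → 1 + n * (n * s) ≤ budget s n
  budget-clauses s {n} 1≤n*n = quadratic n s 1 (≤-trans 1≤n*n (m≤m+n (n * n) _))

  -- There are `n * n` nodes, each costing a constant number of units of quadratic size; this is the
  -- origin of the exponent 4.
  budget-proof : ∀ c s {n} → 1 ≤ n * n → (5 + n * (n * c)) * budget s n ≤ (5 + c) * (5 + s) * n ^ 4
  budget-proof c s {n} 1≤n*n = begin
    (5 + n * (n * c)) * budget s n          ≤⟨ *-monoˡ-≤ (budget s n) (quadratic n c 5 (*-monoʳ-≤ 5 1≤n*n)) ⟩
    (5 + c) * (n * n) * ((5 + s) * (n * n)) ≡⟨ [m*n]*[o*p]≡[m*o]*[n*p] (5 + c) (n * n) (5 + s) (n * n) ⟩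
    (5 + c) * (5 + s) * (n * n * (n * n))   ≡⟨ cong ((5 + c) * (5 + s) *_) fourth ⟩
    (5 + c) * (5 + s) * n ^ 4               ∎
    where
    open ≤-Reasoning
    fourth : n * n * (n * n) ≡ n ^ 4
    fourth = trans (*-assoc n n (n * n)) (cong (λ k → n * (n * (n * k))) (sym (*-identityʳ n)))

-- The refutation for grids of side at least two.

module Grid (m : ℕ) where
  n M D : ℕ
  n = suc (suc m)
  M = budget maxSize n
  -- One level above the clauses, for their conjunction.
  D = suc maxDepth

  1≤n*n : 1 ≤ n * n
  1≤n*n = s≤s z≤n

  1≤M : 1 ≤ M
  1≤M = ≤-trans (s≤s z≤n) (budget-clauses maxSize {n} 1≤n*n)

  stconn-size : fsize (and (stconnClauses n)) ≤ M
  stconn-size = ≤-trans (s≤s (fsizes-stconnClauses n maxSize (λ {i} {j} i<n j<n →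
      nodeClauses-size (proj₂ (locate m i i<n)) (proj₂ (locate m j j<n)))))
    (budget-clauses maxSize {n} 1≤n*n)

  stconn-depth : fdepth (and (stconnClauses n)) ≤ D
  stconn-depth = s≤s (fdepths-stconnClauses n maxDepth (λ {i} {j} i<n j<n →
    nodeClauses-depth (proj₂ (locate m i i<n)) (proj₂ (locate m j j<n))))

  open Derivations (stconnClauses n) M D 1≤M stconn-size stconn-depth

  -- Under `assign` each expansion is literally an `xorS` axiom, and in column 0 the parities before
  -- the node are the empty `xor`.
  axioms-outright : ∀ {q i j} → At m q j → ∀ {A} → A ∈ axioms q → Outright (stconnClauses n) (sub (assign i j) A)
  axioms-outright y (here refl) = axiom _ _
  axioms-outright y (there (here refl)) = axiom _ _
  axioms-outright y (there (there (here refl))) = axiom _ _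
  axioms-outright y (there (there (there (here refl)))) = axiom _ _
  axioms-outright first (there (there (there (there (here refl))))) = empty
  axioms-outright first (there (there (there (there (there (here refl)))))) = empty
  axioms-outright first (there (there (there (there (there (there (here refl))))))) = empty
  axioms-outright first (there (there (there (there (there (there (there (here refl)))))))) = empty

  node : ∀ {p q i j t} → At m p i → At m q j → Lines t (subs (assign i j) (premises p q)) →
         Line (t + maxCost) (sub (assign i j) (conclusion p q))
  node {p} {q} {i} {j} {t} x y ls = Line-mono (+-monoʳ-≤ t (≤-total₉ nodeCost p q))
    (step (premises p q) (axioms q ++ schemaClauses p q) (conclusion p q) (nodeProof p q)
      (≤-trans (≤-total₉ nodeDepth p q) (n≤1+n maxDepth)) facts ls)
    where
    open Instance (assign i j) 3 (assign-size i j (At-< y) (budget-parity maxSize n)) (assign-depth i j)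
    facts : ∀ {A} → A ∈ axioms q ++ schemaClauses p q → Outright (stconnClauses n) (sub (assign i j) A)
    facts A∈ = [ axioms-outright y
               , (λ A∈cl → clause (nodeClauses-∈ {n} {i} {j} (At-< x) (At-< y)
                   (subst (_ ∈_) (subs-schemaClauses (assign i j) (assign-edge i j) x y) (sub-∈ (assign i j) A∈cl))))
               ]′ (∈-++⁻ (axioms q) A∈)

  -- The right boundary of one column is the left boundary of the next.
  shift : ∀ p i j → sub (assign i j) (invariant p 5 7 3) ≡ sub (assign i (suc j)) (invariant p 4 6 2)
  shift first i j = refl
  shift mid i j = refl
  shift last i j = refl

  -- Each line is used only once, so the tree-like proof pays `maxCost` once per node passed.
  row : ∀ {p i} → At m p i → ∀ j → j ≤ m → Line (suc j * maxCost) (sub (assign i (suc j)) (invariant p 4 6 2))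
  row {p} {i} x zero _ = subst (Line _) (shift p i 0)
    (Line-mono (≤-reflexive (sym (+-identityʳ maxCost))) (node {q = first} x first []))
  row {p} {i} x (suc j) j<m = subst (Line _) (shift p i (suc j))
    (Line-mono (≤-reflexive (arith maxCost j)) (node {q = mid} x (mid j<m) (row x j (<⇒≤ j<m) ∷ [])))
    where
    arith : ∀ c j → suc j * c + 0 + c ≡ suc (suc j) * c
    arith = solve-∀

  separation : ∀ i → i ≤ m → Line (suc i * (n * maxCost)) (sub (assign i (suc m)) (separated 7))
  separation zero _ = Line-mono (≤-reflexive (arith maxCost m)) (node first last (row first m ≤-refl ∷ []))
    where
    arith : ∀ c m → suc m * c + 0 + c ≡ 1 * (suc (suc m) * c)
    arith = solve-∀
  -- `separated 7` in row `i` is definitionally `separated 5` in row `suc i`: both concern all the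
  -- crossings between these rows.
  separation (suc i) i<m = Line-mono (≤-reflexive (arith maxCost m i))
    (node (mid i<m) last (row (mid i<m) m ≤-refl ∷ separation i (<⇒≤ i<m) ∷ []))
    where
    arith : ∀ c m i → suc m * c + (suc i * (suc (suc m) * c) + 0) + c ≡ suc (suc i) * (suc (suc m) * c)
    arith = solve-∀

  falsum : Line (n * (n * maxCost)) (or [])
  falsum = Line-mono (≤-reflexive (arith maxCost m)) (node last last (row last m ≤-refl ∷ separation m ≤-refl ∷ []))
    where
    arith : ∀ c m → suc m * c + (suc m * (suc (suc m) * c) + 0) + c ≡ suc (suc m) * (suc (suc m) * c)
    arith = solve-∀

  refutation : Σ ([] ⊢ [ STCONN n ]) (λ π → (pdepth π ≤ suc D) × (psize π ≤ (5 + maxCost) * (5 + maxSize) * n ^ 4))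
  refutation = map₂ (map₂ (λ π-size → ≤-trans π-size (budget-proof maxCost maxSize {n} 1≤n*n))) (refute falsum)

-- The only node has no edge slots, so its degree-one constraint is the empty clause.
refutation₁ : [] ⊢ [ STCONN 1 ]
refutation₁ = negR (andL (here refl) (orL []))

theorem6p1 : ∃[ d ] ∃[ c ] ∃[ k ] ((n : ℕ) → 1 ≤ n →
    Σ ([] ⊢ [ STCONN n ]) (λ π → (pdepth π ≤ d) × (psize π ≤ c * n ^ k)))
theorem6p1 = d , c , 4 , prove
  where
  c₂ c d : ℕ
  c₂ = (5 + maxCost) * (5 + maxSize)
  c = psize refutation₁ + c₂
  -- The two extra levels are the conjunction of the clauses and its negation.
  d = pdepth refutation₁ ⊔ suc (suc maxDepth)
  prove : (n : ℕ) → 1 ≤ n → Σ ([] ⊢ [ STCONN n ]) (λ π → (pdepth π ≤ d) × (psize π ≤ c * n ^ 4))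
  prove (suc zero) _ = refutation₁ , m≤m⊔n (pdepth refutation₁) (suc (suc maxDepth)) ,
    ≤-trans (m≤m+n (psize refutation₁) c₂) (≤-reflexive (sym (*-identityʳ c)))
  prove (suc (suc m)) _ = map₂ (λ (π-depth , π-size) →
    ≤-trans π-depth (m≤n⊔m (pdepth refutation₁) (suc (suc maxDepth))) ,
    ≤-trans π-size (*-monoˡ-≤ (suc (suc m) ^ 4) (m≤n+m c₂ (psize refutation₁)))) (Grid.refutation m)
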